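{- Let $k$ be a positive integer. Every $f \in \mathbb{N}_0[x_1^{\pm 1}, \ldots, x_k^{\pm 1}]$ with $f(1, \ldots, 1) > 3$ and $|\mathrm{supp}(f)| > 1$ can be written as the sum of two multiplicative irreducibles of $\mathbb{N}_0[x_1^{\pm 1}, \ldots, x_k^{\pm 1}]$.
   Context: $\mathbb{N}_0$ is the semiring of nonnegative integers, and $\mathbb{N}_0[x_1^{\pm 1}, \ldots, x_k^{\pm 1}]$ is the semiring of Laurent polynomials in $k$ variables with coefficients in $\mathbb{N}_0$. $\mathrm{supp}(f) \subseteq \mathbb{Z}^k$ is the set of exponent vectors of $f$ with nonzero coefficient, so $|\mathrm{supp}(f)|>1$ means that $f$ is nonzero and not a monomial $c\,x_1^{n_1}\cdots x_k^{n_k}$. A multiplicative irreducible of a semiring $T$ (contained in an integral domain) is a nonzero non-unit $a \in T$ such that $a = bc$ with $b, c \in T$ implies that $b$ or $c$ is a unit of $T$ (i.e., has a multiplicative inverse in $T$). -}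

module Defs where

open import Algebra.Bundles.Raw using (RawSemiring)
import Algebra.Definitions
import Algebra.Definitions.RawSemiring as SemiringDefinitions
open import Data.Bool.Base using (if_then_else_)
open import Data.Integer.Base as ℤ using (ℤ; +_; -[1+_])
import Data.Integer.Properties as ℤₚ
open import Data.List.Base as List using (List; []; _∷_; _++_)
open import Data.Nat.Base as ℕ using (ℕ; suc)
import Data.Nat.Properties as ℕₚ
open import Data.Nat.ListAction using (sum)
open import Data.Product.Base using (Σ; _×_; _,_; proj₁; proj₂)
open import Data.Vec.Base as Vec using (Vec)
import Data.Vec.Properties as Vecₚ
open import Level using (0ℓ; _⊔_)
open import Relation.Binary.Definitions using (DecidableEquality)
open import Relation.Binary.PropositionalEquality.Core using (_≡_; refl)
open import Relation.Nullary.Decidable.Core using (does; ¬?)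

module _ {c ℓ} (T : RawSemiring c ℓ) where
  open RawSemiring T
  open SemiringDefinitions T using (Irreducible)

  -- `Irreducible` says that a is a non-unit and that a ≈ x * y forces x or y
  -- to be a unit (a divisor of 1#).
  MultiplicativeIrreducible : Carrier → Set (c ⊔ ℓ)
  MultiplicativeIrreducible a = a ≉ 0# × Irreducible a

Exponent : ℕ → Set
Exponent k = Vec ℤ k

infix 4 _≟ᵉ_
_≟ᵉ_ : ∀ {k} → DecidableEquality (Exponent k)
_≟ᵉ_ = Vecₚ.≡-dec ℤₚ._≟_

-- A Laurent polynomial with coefficients in ℕ is written as a finite list of
-- terms (c , n), standing for the sum of the c x₁^n₁ ⋯ xₖ^nₖ.  Exponents may
-- repeat and c may be 0; polynomials are compared by _≈_ below, never by _≡_.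
Laurent : ℕ → Set
Laurent k = List (ℕ × Exponent k)

coeff : ∀ {k} → Laurent k → Exponent k → ℕ
coeff f n = sum (List.map (λ (c , m) → if does (m ≟ᵉ n) then c else 0) f)

infix 4 _≈_
_≈_ : ∀ {k} → Laurent k → Laurent k → Set
f ≈ g = ∀ n → coeff f n ≡ coeff g n

_*ᵗ_ : ∀ {k} → ℕ × Exponent k → ℕ × Exponent k → ℕ × Exponent k
(c , m) *ᵗ (d , n) = c ℕ.* d , Vec.zipWith ℤ._+_ m n

ℕ[x^±1] : ℕ → RawSemiring 0ℓ 0ℓ
ℕ[x^±1] k = record
  { Carrier = Laurent k
  ; _≈_     = _≈_
  ; _+_     = _++_
  ; _*_     = List.cartesianProductWith _*ᵗ_
  ; 0#      = []
  ; 1#      = (1 , Vec.replicate k (+ 0)) ∷ []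
  }

supp : ∀ {k} → Laurent k → List (Exponent k)
supp f = List.deduplicate _≟ᵉ_
  (List.filter (λ n → ¬? (coeff f n ℕₚ.≟ 0)) (List.map proj₂ f))

-- Evaluation needs negative powers, so it is defined at points with invertible
-- coordinates, each carried together with its inverse.
ℕˣ : Set
ℕˣ = Σ ℕ (Algebra.Definitions.Invertible _≡_ 1 ℕ._*_)

𝟙 : ℕˣ
𝟙 = 1 , 1 , refl , refl

infixr 8 _^ᶻ_
_^ᶻ_ : ℕˣ → ℤ → ℕ
(a , _)       ^ᶻ (+ n)    = a ℕ.^ n
(_ , a⁻¹ , _) ^ᶻ -[1+ n ] = a⁻¹ ℕ.^ suc n

monomialAt : ∀ {k} → Vec ℕˣ k → Exponent k → ℕ
monomialAt a n = Vec.foldr _ ℕ._*_ 1 (Vec.zipWith _^ᶻ_ a n)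

eval : ∀ {k} → Laurent k → Vec ℕˣ k → ℕ
eval f a = sum (List.map (λ (c , n) → c ℕ.* monomialAt a n) f)

{-# OPTIONS --safe #-}
-- Write f as the multiset of its exponents and choose a coordinate w on which they
-- are not all equal, with minimum a attained at s and maximum b attained at t.  If
-- p ∷ us is a product of two non-monomials, then us contains the other three corners
-- of a (possibly degenerate) parallelogram i + j = p + l; bounds on w exclude this.
-- Compare 2w with M = a + b.  If at most one term has 2w = M, then s together with
-- the terms 2w ≥ M other than t, and t together with the terms 2w < M other than s,
-- are irreducible, unless one of them is a single monomial; in that case any two
-- suitable terms split off from the rest form an irreducible instead.  If at least
-- two terms have 2w = M, one of these, m, joins the terms with w = b or 2w < M
-- except s, and the remaining ones join s and the terms with M < 2w < 2b.

module Submission where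

open import Defs using (Laurent; ℕ[x^±1]; MultiplicativeIrreducible; eval; 𝟙; supp)
open import Algebra.Bundles.Raw using (RawSemiring)
open import Data.List.Base using (length)
open import Data.Nat.Base using (ℕ; NonZero; _>_)
open import Data.Product.Base using (_×_; ∃₂)
open import Data.Vec.Base using (replicate)

open import Defs using (Exponent; _≟ᵉ_; coeff; _*ᵗ_; monomialAt; _^ᶻ_)
  renaming (_≈_ to _≋_)
open import Algebra.Bundles using (module AbelianGroup)
import Algebra.Definitions.RawMagma as MagmaDefinitions
import Algebra.Definitions.RawSemiring as SemiringDefinitions
import Algebra.Properties.CommutativeSemigroup as CommutativeSemigroupProperties
import Algebra.Properties.Group as GroupProperties
open import Data.Empty using (⊥; ⊥-elim)
open import Data.Fin.Base using (Fin)
open import Data.Fin.Properties using (¬∀⟶∃¬)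
open import Data.Integer.Base as ℤ using (ℤ)
import Data.Integer.Properties as ℤₚ
open import Data.List.Base as List
  using (List; []; _∷_; [_]; _++_; map; concatMap; cartesianProductWith)
open import Data.List.Extrema ℤₚ.≤-totalOrder
  using (argmin; argmax; argmin-all; argmax-all; f[argmin]≤f[xs]; f[xs]≤f[argmax])
open import Data.List.Membership.Propositional using (_∈_)
open import Data.List.Membership.Propositional.Properties
  using (∈-∃++; ∈-++⁻; ∈-map⁺; ∈-map⁻; ∈-deduplicate⁻; ∈-filter⁻;
         ∈-cartesianProductWith⁺; ∈-cartesianProductWith⁻)
import Data.List.Properties as Listₚ
open import Data.List.Relation.Binary.Permutation.Propositional
open import Data.List.Relation.Binary.Permutation.Propositional.Properties hiding (sum-↭)
open import Data.List.Relation.Unary.All as All using (All; []; _∷_)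
import Data.List.Relation.Unary.All.Properties as Allₚ
open import Data.List.Relation.Unary.AllPairs using (AllPairs; []; _∷_)
open import Data.List.Relation.Unary.Any using (here; there)
open import Data.List.Relation.Unary.Unique.DecPropositional.Properties using (deduplicate-!)
import Data.List.Relation.Binary.Permutation.Setoid.Properties as ↭ₛ
import Data.Nat.Base as ℕ
open import Data.Nat.ListAction using (sum)
open import Data.Nat.ListAction.Properties using (sum-++; sum-↭)
import Data.Nat.Properties as ℕₚ
open import Data.Product.Base using (∃; _,_; proj₁; proj₂)
open import Data.Sum.Base as Sum using (_⊎_; inj₁; inj₂)
open import Data.Vec.Base as Vec using ([]; _∷_)
import Data.Vec.Properties as Vecₚ
open import Function.Base using (_∘_)
open import Relation.Binary.PropositionalEquality as ≡ using (_≡_; _≢_)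
open import Relation.Nullary.Decidable.Core using (Dec; yes; no; ¬?)
open import Relation.Nullary.Negation.Core using (¬_; contradiction)

-- Addition of exponent vectors

infixl 6 _⊕_
_⊕_ : ∀ {k} → Exponent k → Exponent k → Exponent k
_⊕_ = Vec.zipWith ℤ._+_

⊕-comm : ∀ {k} (m n : Exponent k) → m ⊕ n ≡ n ⊕ m
⊕-comm = Vecₚ.zipWith-comm ℤₚ.+-comm

⊕-interchange : ∀ {k} (m n o p : Exponent k) → (m ⊕ n) ⊕ (o ⊕ p) ≡ (m ⊕ o) ⊕ (n ⊕ p)
⊕-interchange []       []       []       []       = ≡.refl
⊕-interchange (m ∷ ms) (n ∷ ns) (o ∷ os) (p ∷ ps) =
  ≡.cong₂ _∷_ (ℤ-interchange m n o p) (⊕-interchange ms ns os ps)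
  where open CommutativeSemigroupProperties ℤₚ.+-commutativeSemigroup
          renaming (interchange to ℤ-interchange)

infixl 7 _⊗_
-- The sumset counted with multiplicity: it is what multiplication of polynomials becomes on
-- multisets of exponents.
_⊗_ : ∀ {k} → List (Exponent k) → List (Exponent k) → List (Exponent k)
_⊗_ = cartesianProductWith _⊕_

-- Permutations of lists

module _ {a} {A : Set a} where

  ∈⇒↭∷ : ∀ {x : A} {xs} → x ∈ xs → ∃ λ ys → xs ↭ x ∷ ys
  ∈⇒↭∷ x∈xs with ys , zs , ≡.refl ← ∈-∃++ x∈xs = ys ++ zs , shift _ ys zs

  ∈₃⇒↭∷ : ∀ {x y z : A} {xs ys zs} → x ∈ xs → y ∈ ys → z ∈ zs →
           ∃ λ ws → xs ++ ys ++ zs ↭ x ∷ y ∷ z ∷ ws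
  ∈₃⇒↭∷ {x} {y} {z} x∈ y∈ z∈ with xs′ , p ← ∈⇒↭∷ x∈ | ys′ , q ← ∈⇒↭∷ y∈ | zs′ , r ← ∈⇒↭∷ z∈ =
    xs′ ++ ys′ ++ zs′ ,
    ↭-trans (++⁺ p (++⁺ q r))
      (prep x (↭-trans (shift y xs′ (ys′ ++ z ∷ zs′))
        (prep y (↭-trans (++⁺ˡ xs′ (shift z ys′ zs′)) (shift z xs′ (ys′ ++ zs′))))))

  module _ {p} {P : A → Set p} (P? : ∀ x → Dec (P x)) where

    separate : ∀ xs → ∃₂ λ ys zs → xs ↭ ys ++ zs × All P ys × All (λ x → ¬ P x) zs
    separate [] = [] , [] , ↭-refl , [] , []
    separate (x ∷ xs) with separate xs | P? x
    ... | ys , zs , σ , Pys , ¬Pzs | yes Px = x ∷ ys , zs , prep x σ , Px ∷ Pys , ¬Pzs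
    ... | ys , zs , σ , Pys , ¬Pzs | no ¬Px =
      ys , x ∷ zs , ↭-trans (prep x σ) (↭-sym (shift x ys zs)) , Pys , ¬Px ∷ ¬Pzs

-- Sumsets of multisets of exponents

module _ {k : ℕ} where

  private
    variable
      n : Exponent k
      xs ys zs : List (Exponent k)

  ⊗-cong : ∀ {ws} → ws ↭ xs → ys ↭ zs → ws ⊗ ys ↭ xs ⊗ zs
  ⊗-cong {xs} {ys} {zs} ws↭xs ys↭zs = ↭-trans (congʳ ws↭xs) (congˡ xs)
    where
    congʳ : ∀ {us vs} → us ↭ vs → us ⊗ ys ↭ vs ⊗ ys
    congʳ refl         = refl
    congʳ (prep u σ)   = ++⁺ˡ (map (u ⊕_) ys) (congʳ σ)
    congʳ (swap u v σ) = ↭-trans (++⁺ˡ (map (u ⊕_) ys) (++⁺ˡ (map (v ⊕_) ys) (congʳ σ)))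
                                 (shifts (map (u ⊕_) ys) (map (v ⊕_) ys))
    congʳ (trans σ τ)  = ↭-trans (congʳ σ) (congʳ τ)

    congˡ : ∀ us → us ⊗ ys ↭ us ⊗ zs
    congˡ []       = refl
    congˡ (u ∷ us) = ++⁺ (map⁺ (u ⊕_) ys↭zs) (congˡ us)

  -- Splits off the column of `n`. Together with the row that the definition splits off for the
  -- first factor, this isolates one chosen corner of a product.
  ⊗-∷ʳ : ∀ (xs : List (Exponent k)) n ys → xs ⊗ (n ∷ ys) ↭ map (_⊕ n) xs ++ xs ⊗ ys
  ⊗-∷ʳ []       n ys = refl
  ⊗-∷ʳ (m ∷ xs) n ys = prep (m ⊕ n)
    (↭-trans (++⁺ˡ (map (m ⊕_) ys) (⊗-∷ʳ xs n ys))
             (shifts (map (m ⊕_) ys) (map (_⊕ n) xs)))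

  -- Laurent polynomials as multisets of exponents

  -- A coefficient `c` becomes `c` copies of its exponent, so zero terms vanish, repeated exponents
  -- merge, and `_≋_` turns into permutation of lists.
  expand : Laurent k → List (Exponent k)
  expand = concatMap (λ (c , n) → List.replicate c n)

  terms : List (Exponent k) → Laurent k
  terms = map (1 ,_)

  expand-terms : ∀ xs → expand (terms xs) ≡ xs
  expand-terms []       = ≡.refl
  expand-terms (n ∷ xs) = ≡.cong (n ∷_) (expand-terms xs)

  coeff-++ : ∀ (f g : Laurent k) n → coeff (f ++ g) n ≡ coeff f n ℕ.+ coeff g n
  coeff-++ f g n = ≡.trans (≡.cong sum (Listₚ.map-++ _ f g)) (sum-++ (map _ f) (map _ g))

  coeff-replicate : ∀ c m n → coeff (terms (List.replicate c m)) n ≡ coeff [ (c , m) ] n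
  coeff-replicate ℕ.zero m n with m ≟ᵉ n
  ... | yes _ = ≡.refl
  ... | no  _ = ≡.refl
  coeff-replicate (ℕ.suc c) m n with m ≟ᵉ n | coeff-replicate c m n
  ... | yes _ | eq = ≡.cong ℕ.suc eq
  ... | no  _ | eq = eq

  ≋-terms-expand : ∀ f → f ≋ terms (expand f)
  ≋-terms-expand []            n = ≡.refl
  ≋-terms-expand ((c , m) ∷ f) n = begin
    coeff ((c , m) ∷ f) n
      ≡⟨ coeff-++ [ (c , m) ] f n ⟩
    coeff [ (c , m) ] n ℕ.+ coeff f n
      ≡⟨ ≡.cong₂ ℕ._+_ (coeff-replicate c m n) (≡.sym (≋-terms-expand f n)) ⟨
    coeff (terms (List.replicate c m)) n ℕ.+ coeff (terms (expand f)) n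
      ≡⟨ coeff-++ (terms (List.replicate c m)) (terms (expand f)) n ⟨
    coeff (terms (List.replicate c m) ++ terms (expand f)) n
      ≡⟨ ≡.cong (λ g → coeff g n) (Listₚ.map-++ (1 ,_) (List.replicate c m) (expand f)) ⟨
    coeff (terms (expand ((c , m) ∷ f))) n ∎
    where open ≡.≡-Reasoning

  ↭⇒terms-≋ : xs ↭ ys → terms xs ≋ terms ys
  ↭⇒terms-≋ σ n = sum-↭ (map⁺ _ (map⁺ (1 ,_) σ))

  coeff-terms≢0⇒∈ : ∀ xs → coeff (terms xs) n ≢ 0 → n ∈ xs
  coeff-terms≢0⇒∈         []       c≢0 = contradiction ≡.refl c≢0
  coeff-terms≢0⇒∈ {n = n} (m ∷ xs) c≢0 with m ≟ᵉ n
  ... | yes ≡.refl = here ≡.refl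
  ... | no  _      = there (coeff-terms≢0⇒∈ xs c≢0)

  coeff-terms-∷ : ∀ n xs → coeff (terms (n ∷ xs)) n ≢ 0
  coeff-terms-∷ n xs eq with n ≟ᵉ n
  coeff-terms-∷ n xs () | yes _
  ... | no n≢n = n≢n ≡.refl

  -- The head `x` has nonzero coefficient on the left, hence on the right, so it occurs in `ys`.
  -- Removing it from both sides subtracts the same amount from every coefficient, and induction
  -- applies.
  terms-≋⇒↭ : ∀ xs ys → terms xs ≋ terms ys → xs ↭ ys
  terms-≋⇒↭ []       []       eq = refl
  terms-≋⇒↭ []       (y ∷ ys) eq = contradiction (≡.sym (eq y)) (coeff-terms-∷ y ys)
  terms-≋⇒↭ (x ∷ xs) ys       eq
    with ys′ , σ ← ∈⇒↭∷ (coeff-terms≢0⇒∈ ys λ e → coeff-terms-∷ x xs (≡.trans (eq x) e)) =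
    ↭-trans (prep x (terms-≋⇒↭ xs ys′ eq′)) (↭-sym σ)
    where
    eq′ : terms xs ≋ terms ys′
    eq′ n = ℕₚ.+-cancelˡ-≡ (coeff [ (1 , x) ] n) _ _ (begin
      coeff [ (1 , x) ] n ℕ.+ coeff (terms xs) n   ≡⟨ coeff-++ [ (1 , x) ] (terms xs) n ⟨
      coeff (terms (x ∷ xs)) n                     ≡⟨ eq n ⟩
      coeff (terms ys) n                           ≡⟨ ↭⇒terms-≋ σ n ⟩
      coeff (terms (x ∷ ys′)) n                    ≡⟨ coeff-++ [ (1 , x) ] (terms ys′) n ⟩
      coeff [ (1 , x) ] n ℕ.+ coeff (terms ys′) n  ∎)
      where open ≡.≡-Reasoning

  ≋⇒expand-↭ : ∀ f g → f ≋ g → expand f ↭ expand g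
  ≋⇒expand-↭ f g f≋g = terms-≋⇒↭ (expand f) (expand g) λ n →
    ≡.trans (≡.sym (≋-terms-expand f n)) (≡.trans (f≋g n) (≋-terms-expand g n))

  expand-↭⇒≋ : ∀ f g → expand f ↭ expand g → f ≋ g
  expand-↭⇒≋ f g σ n =
    ≡.trans (≋-terms-expand f n) (≡.trans (↭⇒terms-≋ σ n) (≡.sym (≋-terms-expand g n)))

  -- Multiplication as a sumset

  open RawSemiring (ℕ[x^±1] k) using (_*_; 1#)
  open SemiringDefinitions (ℕ[x^±1] k) using (_∣_; mkIrred)
  open MagmaDefinitions (RawSemiring.*-rawMagma (ℕ[x^±1] k)) using (_,_)

  expand-++ : ∀ f g → expand (f ++ g) ≡ expand f ++ expand g
  expand-++ = Listₚ.concatMap-++ _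

  -- Each unit of the coefficient `c` contributes one translate of `expand g` by `m`, hence the
  -- induction on `c`.
  expand-scale : ∀ c m g → expand (map ((c , m) *ᵗ_) g) ↭ List.replicate c m ⊗ expand g
  expand-scale ℕ.zero    m []            = refl
  expand-scale ℕ.zero    m (_ ∷ g)       = expand-scale ℕ.zero m g
  expand-scale (ℕ.suc c) m g = ↭-trans (expand-suc g) (++⁺ˡ _ (expand-scale c m g))
    where
    replicate-+ : ∀ a b (n : Exponent k) →
                  List.replicate (a ℕ.+ b) n ≡ List.replicate a n ++ List.replicate b n
    replicate-+ ℕ.zero    b n = ≡.refl
    replicate-+ (ℕ.suc a) b n = ≡.cong (n ∷_) (replicate-+ a b n)

    expand-suc : ∀ g → expand (map ((ℕ.suc c , m) *ᵗ_) g) ↭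
                 map (m ⊕_) (expand g) ++ expand (map ((c , m) *ᵗ_) g)
    expand-suc [] = refl
    expand-suc ((d , n) ∷ g) = begin
      List.replicate (d ℕ.+ c ℕ.* d) (m ⊕ n) ++ expand (map ((ℕ.suc c , m) *ᵗ_) g)
        ≡⟨ ≡.cong (_++ _) (replicate-+ d (c ℕ.* d) (m ⊕ n)) ⟩
      (ds ++ cds) ++ expand (map ((ℕ.suc c , m) *ᵗ_) g)
        ↭⟨ ++⁺ˡ (ds ++ cds) (expand-suc g) ⟩
      (ds ++ cds) ++ (mg ++ cg)
        ≡⟨ Listₚ.++-assoc ds cds (mg ++ cg) ⟩
      ds ++ (cds ++ (mg ++ cg))
        ↭⟨ ++⁺ˡ ds (shifts cds mg) ⟩
      ds ++ (mg ++ (cds ++ cg))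
        ≡⟨ Listₚ.++-assoc ds mg (cds ++ cg) ⟨
      (ds ++ mg) ++ (cds ++ cg)
        ≡⟨ ≡.cong (λ es → (es ++ mg) ++ (cds ++ cg)) (Listₚ.map-replicate (m ⊕_) d n) ⟨
      (map (m ⊕_) (List.replicate d n) ++ mg) ++ (cds ++ cg)
        ≡⟨ ≡.cong (_++ (cds ++ cg)) (Listₚ.map-++ (m ⊕_) (List.replicate d n) (expand g)) ⟨
      map (m ⊕_) (List.replicate d n ++ expand g) ++ (cds ++ cg) ∎
      where
      open PermutationReasoning
      ds = List.replicate d (m ⊕ n)
      cds = List.replicate (c ℕ.* d) (m ⊕ n)
      mg = map (m ⊕_) (expand g)
      cg = expand (map ((c , m) *ᵗ_) g)

  expand-* : ∀ f g → expand (f * g) ↭ expand f ⊗ expand g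
  expand-* []            g = refl
  expand-* ((c , m) ∷ f) g = begin
    expand (map ((c , m) *ᵗ_) g ++ f * g)
      ≡⟨ expand-++ (map ((c , m) *ᵗ_) g) (f * g) ⟩
    expand (map ((c , m) *ᵗ_) g) ++ expand (f * g)
      ↭⟨ ++⁺ (expand-scale c m g) (expand-* f g) ⟩
    List.replicate c m ⊗ expand g ++ expand f ⊗ expand g
      ≡⟨ Listₚ.cartesianProductWith-distribʳ-++ _⊕_ (List.replicate c m) (expand f) (expand g) ⟨
    expand ((c , m) ∷ f) ⊗ expand g ∎
    where open PermutationReasoning

  -- Irreducibility criteria

  -- The inverse is the monomial with the negated exponent.
  monomial∣1 : ∀ f → expand f ↭ [ n ] → f ∣ 1#
  monomial∣1 {n = n} f σ = n⁻¹ , expand-↭⇒≋ (n⁻¹ * f) 1#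
    (↭-trans (expand-* n⁻¹ f) (↭-trans (⊗-cong {xs = [ Vec.map ℤ.-_ n ]} refl σ)
      (↭-reflexive (≡.cong [_] (Vecₚ.zipWith-inverseˡ ℤₚ.+-inverseˡ n)))))
    where
    n⁻¹ : Laurent k
    n⁻¹ = [ (1 , Vec.map ℤ.-_ n) ]

  -- The number of terms counted with multiplicity is multiplicative, and it is 1 for `1#`.
  ∣1⇒length≡1 : ∀ f → f ∣ 1# → length (expand f) ≡ 1
  ∣1⇒length≡1 f (g , gf≋1) = ℕₚ.m*n≡1⇒n≡1 (length (expand g)) _ (begin
    length (expand g) ℕ.* length (expand f)  ≡⟨ length-⊗ (expand g) (expand f) ⟨
    length (expand g ⊗ expand f)             ≡⟨ ↭-length (expand-* g f) ⟨
    length (expand (g * f))                  ≡⟨ ↭-length (≋⇒expand-↭ (g * f) 1# gf≋1) ⟩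
    1                                        ∎)
    where
    open ≡.≡-Reasoning
    length-⊗ : ∀ xs ys → length (xs ⊗ ys) ≡ length xs ℕ.* length ys
    length-⊗ []       ys = ≡.refl
    length-⊗ (x ∷ xs) ys = ≡.trans (Listₚ.length-++ (map (x ⊕_) ys))
      (≡.cong₂ ℕ._+_ (Listₚ.length-map (x ⊕_) ys) (length-⊗ xs ys))

  -- If p ∷ us is a product with both factors of length at least 2, write p = s + t
  -- and take further terms s′, t′ of the factors: us contains the other three
  -- corners s + t′, s′ + t, s′ + t′ of a parallelogram at p.  Moreover s′ and t′ can
  -- be chosen so that a given q ∈ us is among these corners.
  no-parallelogram⇒irreducible : ∀ p {q us} → q ∈ us →
    (∀ {j l vs} → us ↭ q ∷ j ∷ l ∷ vs → q ⊕ j ≢ p ⊕ l) →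
    (∀ {i j vs} → us ↭ i ∷ j ∷ q ∷ vs → i ⊕ j ≢ p ⊕ q) →
    MultiplicativeIrreducible (ℕ[x^±1] k) (terms (p ∷ us))
  no-parallelogram⇒irreducible p {q} {us} q∈us not-side not-opposite =
    (λ eq → ¬x∷xs↭[] (terms-≋⇒↭ (p ∷ us) [] eq)) ,
    mkIrred (λ unit → nonunit q∈us (≡.trans (≡.sym (≡.cong length (expand-terms (p ∷ us))))
                                            (∣1⇒length≡1 (terms (p ∷ us)) unit)))
            (λ {f} {g} eq → factor f g (≡.subst (_↭ expand f ⊗ expand g) (expand-terms (p ∷ us))
              (↭-trans (≋⇒expand-↭ (terms (p ∷ us)) (f * g) eq) (expand-* f g))))
    where
    nonunit : ∀ {ws} → q ∈ ws → length (p ∷ ws) ≢ 1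
    nonunit (here _)  ()
    nonunit (there _) ()

    -- The factors are `s ∷ xs` and `t ∷ ys`. Once the corner `p` is removed, their product consists
    -- of the rest of the row of `s`, the rest of the column of `t`, and the interior.
    module _ {s t xs ys} (p≡s⊕t : p ≡ s ⊕ t)
             (σ : us ↭ map (s ⊕_) ys ++ map (_⊕ t) xs ++ xs ⊗ ys) where

      corners : ∀ {s′ t′} → s′ ∈ xs → t′ ∈ ys →
                ∃ λ vs → us ↭ s ⊕ t′ ∷ s′ ⊕ t ∷ s′ ⊕ t′ ∷ vs
      corners s′∈ t′∈
        with vs , τ ← ∈₃⇒↭∷ (∈-map⁺ (s ⊕_) t′∈) (∈-map⁺ (_⊕ t) s′∈)
                             (∈-cartesianProductWith⁺ _⊕_ s′∈ t′∈) = vs , ↭-trans σ τ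

      diagonals : ∀ s′ t′ → (s ⊕ t′) ⊕ (s′ ⊕ t) ≡ p ⊕ (s′ ⊕ t′)
      diagonals s′ t′ = begin
        (s ⊕ t′) ⊕ (s′ ⊕ t)  ≡⟨ ≡.cong ((s ⊕ t′) ⊕_) (⊕-comm s′ t) ⟩
        (s ⊕ t′) ⊕ (t ⊕ s′)  ≡⟨ ⊕-interchange s t′ t s′ ⟩
        (s ⊕ t) ⊕ (t′ ⊕ s′)  ≡⟨ ≡.cong₂ _⊕_ p≡s⊕t (⊕-comm s′ t′) ⟨
        p ⊕ (s′ ⊕ t′)        ∎
        where open ≡.≡-Reasoning

      impossible : ∀ {s′ t′} → s′ ∈ xs → t′ ∈ ys → ⊥
      impossible s′∈ t′∈ with ∈-++⁻ (map (s ⊕_) ys) (∈-resp-↭ σ q∈us)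
      -- If `q` lies in the row or the column, it is adjacent to `p` and the other factor's term is
      -- arbitrary; if it lies in the interior, it is opposite to `p` and determines both terms.
      ... | inj₁ q∈ with t″ , t″∈ , ≡.refl ← ∈-map⁻ (s ⊕_) q∈ =
        not-side (proj₂ (corners s′∈ t″∈)) (diagonals _ t″)
      ... | inj₂ q∈ with ∈-++⁻ (map (_⊕ t) xs) q∈
      ...   | inj₁ q∈ with s″ , s″∈ , ≡.refl ← ∈-map⁻ (_⊕ t) q∈ =
        not-side (↭-trans (proj₂ (corners s″∈ t′∈)) (swap _ _ refl))
                 (≡.trans (⊕-comm (s″ ⊕ t) _) (diagonals s″ _))
      ...   | inj₂ q∈ with s″ , t″ , s″∈ , t″∈ , ≡.refl ← ∈-cartesianProductWith⁻ _⊕_ xs ys q∈ =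
        not-opposite (proj₂ (corners s″∈ t″∈)) (diagonals s″ t″)

    factor : ∀ f g → p ∷ us ↭ expand f ⊗ expand g → f ∣ 1# ⊎ g ∣ 1#
    factor f g ρ
      with s , t , s∈ , t∈ , p≡s⊕t ←
             ∈-cartesianProductWith⁻ _⊕_ (expand f) (expand g) (∈-resp-↭ ρ (here ≡.refl))
      with ∈⇒↭∷ s∈ | ∈⇒↭∷ t∈
    -- A factor with a single term is a unit; otherwise both factors have a further term and a
    -- parallelogram arises.
    ... | []      , σ | _       , _ = inj₁ (monomial∣1 f σ)
    ... | _ ∷ _   , _ | []      , τ = inj₂ (monomial∣1 g τ)
    ... | xs@(_ ∷ _) , σ | ys@(_ ∷ _) , τ =
      ⊥-elim (impossible {xs = xs} {ys} p≡s⊕t (drop-∷ rest) (here ≡.refl) (here ≡.refl))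
      where
      rest : p ∷ us ↭ p ∷ map (s ⊕_) ys ++ map (_⊕ t) xs ++ xs ⊗ ys
      rest = ↭-trans ρ (↭-trans (⊗-cong σ τ) (↭-trans
        (++⁺ˡ (map (s ⊕_) (t ∷ ys)) (⊗-∷ʳ xs t ys))
        (↭-reflexive (≡.cong (_∷ _) (≡.sym p≡s⊕t)))))

-- Weights

open GroupProperties (AbelianGroup.group ℤₚ.+-0-abelianGroup)
  using () renaming (∙-cancelˡ to ℤ-cancelˡ; ∙-cancelʳ to ℤ-cancelʳ)

double-cancel-< : ∀ {x y} → x ℤ.+ x ℤ.< y ℤ.+ y → x ℤ.< y
double-cancel-< 2x<2y = ℤₚ.≰⇒> λ y≤x → ℤₚ.<⇒≱ 2x<2y (ℤₚ.+-mono-≤ y≤x y≤x)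

-- This and its dual turn bounds on doubled weights of single terms into bounds on the sums of
-- pairs.
+-≤-double : ∀ x y → x ℤ.+ y ℤ.≤ x ℤ.+ x ⊎ x ℤ.+ y ℤ.≤ y ℤ.+ y
+-≤-double x y = Sum.map (ℤₚ.+-monoʳ-≤ x) (ℤₚ.+-monoˡ-≤ y) (ℤₚ.≤-total y x)

+-≥-double : ∀ x y → x ℤ.+ x ℤ.≤ x ℤ.+ y ⊎ y ℤ.+ y ℤ.≤ x ℤ.+ y
+-≥-double x y = Sum.map (ℤₚ.+-monoʳ-≤ x) (ℤₚ.+-monoˡ-≤ y) (ℤₚ.≤-total x y)

All⇒AllPairs : ∀ {a p r} {A : Set a} {P : A → Set p} {R : A → A → Set r} →
               (∀ {x y} → P x → P y → R x y) → ∀ {xs} → All P xs → AllPairs R xs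
All⇒AllPairs PP⇒R []         = []
All⇒AllPairs PP⇒R (px ∷ pxs) = All.map (PP⇒R px) pxs ∷ All⇒AllPairs PP⇒R pxs

SumOfTwoIrreducibles : ∀ {k} → List (Exponent k) → Set
SumOfTwoIrreducibles {k} ns = ∃₂ λ (gs hs : List (Exponent k)) →
  MultiplicativeIrreducible (ℕ[x^±1] k) (terms gs) ×
  MultiplicativeIrreducible (ℕ[x^±1] k) (terms hs) ×
  ns ↭ gs ++ hs

sum-resp-↭ : ∀ {k} {ms ns : List (Exponent k)} → ms ↭ ns →
             SumOfTwoIrreducibles ns → SumOfTwoIrreducibles ms
sum-resp-↭ σ (gs , hs , gs-irr , hs-irr , τ) = gs , hs , gs-irr , hs-irr , ↭-trans σ τ

module _ {k : ℕ} (r : Fin k) where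

  private
    w : Exponent k → ℤ
    w n = Vec.lookup n r

    w-parallelogram : ∀ i j p l → i ⊕ j ≡ p ⊕ l → w i ℤ.+ w j ≡ w p ℤ.+ w l
    w-parallelogram i j p l eq = begin
      w i ℤ.+ w j  ≡⟨ Vecₚ.lookup-zipWith ℤ._+_ r i j ⟨
      w (i ⊕ j)    ≡⟨ ≡.cong w eq ⟩
      w (p ⊕ l)    ≡⟨ Vecₚ.lookup-zipWith ℤ._+_ r p l ⟩
      w p ℤ.+ w l  ∎
      where open ≡.≡-Reasoning

  -- In a parallelogram `i ⊕ j ≡ p ⊕ l` both sides have the same weight, yet `P` holds of the weight
  -- on the left and fails on the right. It does not matter which corner is the distinguished one,
  -- so `clash` refutes both configurations.
  separated⇒irreducible : ∀ {ℓ} (P : ℤ → Set ℓ) p {u us} →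
    AllPairs (λ i j → P (w i ℤ.+ w j)) (u ∷ us) →
    All (λ l → ¬ P (w p ℤ.+ w l)) (u ∷ us) →
    MultiplicativeIrreducible (ℕ[x^±1] k) (terms (p ∷ u ∷ us))
  separated⇒irreducible P p {u} {us} pairs all =
    no-parallelogram⇒irreducible p (here ≡.refl) clash clash
    where
    clash : ∀ {i j l vs} → u ∷ us ↭ i ∷ j ∷ l ∷ vs → i ⊕ j ≢ p ⊕ l
    clash {i} {j} {l} σ eq
      -- The pairwise condition survives permutation because it is symmetric in the two terms.
      with (Pij ∷ _) ∷ _ ← ↭ₛ.AllPairs-resp-↭ (≡.setoid (Exponent k))
             (λ {i} {j} → ≡.subst P (ℤₚ.+-comm (w i) (w j)))
             (≡.resp₂ (λ i j → P (w i ℤ.+ w j))) (↭⇒↭ₛ σ) pairs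
         | _ ∷ _ ∷ ¬Pl ∷ _ ← All-resp-↭ σ all =
      ¬Pl (≡.subst P (w-parallelogram i j p l eq) Pij)

  -- With one term besides `m` there are no pairs to check, so the empty predicate separates.
  pair-irreducible : ∀ m n → MultiplicativeIrreducible (ℕ[x^±1] k) (terms (m ∷ n ∷ []))
  pair-irreducible m n = separated⇒irreducible (λ _ → ⊥) m ([] ∷ []) ((λ ()) ∷ [])

  -- Distributing the terms between two extremes of weight

  module _ (s t : Exponent k) (ws<wt : w s ℤ.< w t) where

    private
      M : ℤ
      M = w s ℤ.+ w t

    private
      -- Sums of two terms of `u ∷ us` exceed `M`, while a sum with `s` is at most `w s ℤ.+ w t`,
      -- which is `M`. The lemma `lower` is the mirror image.
      upper : ∀ {u us} → AllPairs (λ i j → M ℤ.< w i ℤ.+ w j) (u ∷ us) →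
              All (λ u → w u ℤ.≤ w t) (u ∷ us) →
              MultiplicativeIrreducible (ℕ[x^±1] k) (terms (s ∷ u ∷ us))
      upper pairs us≤t = separated⇒irreducible (M ℤ.<_) s pairs
        (All.map (λ u≤t M<su → ℤₚ.<⇒≱ M<su (ℤₚ.+-monoʳ-≤ (w s) u≤t)) us≤t)

      lower : ∀ {l ls} → AllPairs (λ i j → w i ℤ.+ w j ℤ.< M) (l ∷ ls) →
              All (λ l → w s ℤ.≤ w l) (l ∷ ls) →
              MultiplicativeIrreducible (ℕ[x^±1] k) (terms (t ∷ l ∷ ls))
      lower pairs s≤ls = separated⇒irreducible (ℤ._< M) t pairs
        (All.map (λ {l} s≤l tl<M → ℤₚ.<⇒≱ tl<M
          (≡.subst (M ℤ.≤_) (ℤₚ.+-comm (w l) (w t)) (ℤₚ.+-monoˡ-≤ (w t) s≤l))) s≤ls)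

    -- Normally `us` joins `s` and `ls` joins `t`. If one of the lists is empty, its extreme term
    -- would be left alone as a unit, so it borrows a term from the other list; the length bound
    -- leaves that list nonempty.
    sparse-middle : ∀ us ls → 1 ℕ.< length (us ++ ls) →
      AllPairs (λ i j → M ℤ.< w i ℤ.+ w j) us → All (λ u → w u ℤ.≤ w t) us →
      AllPairs (λ i j → w i ℤ.+ w j ℤ.< M) ls → All (λ l → w s ℤ.≤ w l) ls →
      SumOfTwoIrreducibles (s ∷ t ∷ us ++ ls)
    sparse-middle (u ∷ us) (l ∷ ls) _ us-pairs us≤t ls-pairs s≤ls =
      s ∷ u ∷ us , t ∷ l ∷ ls , upper us-pairs us≤t , lower ls-pairs s≤ls ,
      prep s (↭-sym (shift t (u ∷ us) (l ∷ ls)))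
    sparse-middle [] (x ∷ y ∷ ls) _ _ _ (_ ∷ ls-pairs) (_ ∷ s≤ls) =
      s ∷ x ∷ [] , t ∷ y ∷ ls , pair-irreducible s x , lower ls-pairs s≤ls ,
      prep s (swap t x refl)
    sparse-middle (x ∷ y ∷ us) [] _ (_ ∷ us-pairs) (_ ∷ us≤t) _ _ =
      t ∷ x ∷ [] , s ∷ y ∷ us , pair-irreducible t x , upper us-pairs us≤t ,
      ↭-trans (swap s t (++-identityʳ (x ∷ y ∷ us))) (prep t (swap s x refl))
    sparse-middle []       []       ()
    sparse-middle []       (_ ∷ []) (ℕ.s≤s ())
    sparse-middle (_ ∷ []) []       (ℕ.s≤s ())

    -- The second summand may contain many parallelograms at m, but none of them has
    -- the topmost term t as a corner.
    dense-middle : ∀ m m′ cs us ts ls → All (λ c → w c ℤ.+ w c ≡ M) (m ∷ m′ ∷ cs) →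
      All (λ u → M ℤ.≤ w u ℤ.+ w u × w u ℤ.< w t) us →
      All (λ n → w n ≡ w t) ts →
      All (λ l → w l ℤ.+ w l ℤ.< M × w s ℤ.≤ w l) ls →
      SumOfTwoIrreducibles (s ∷ t ∷ (m ∷ m′ ∷ cs ++ us) ++ ts ++ ls)
    dense-middle m m′ cs us ts ls (2m≡M ∷ 2cs≡M) us-bounds ts≡t ls-bounds =
      s ∷ m′ ∷ cs ++ us , m ∷ t ∷ ts ++ ls ,
      -- The threshold is weak here: two middle terms may sum to exactly `M`, but a sum with `s` is
      -- strictly below `M` since all terms of weight `w t` are in the other summand.
      separated⇒irreducible (M ℤ.≤_) s
        (All⇒AllPairs M≤+ tops) (All.map s+u<M tops) ,
      no-parallelogram⇒irreducible m (here ≡.refl)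
        (λ σ → side (All-resp-↭ σ bottoms)) (λ σ → opposite (All-resp-↭ σ bottoms)) ,
      prep s (↭-trans (shifts (t ∷ m ∷ []) (m′ ∷ cs ++ us))
                      (++⁺ˡ (m′ ∷ cs ++ us) (swap t m refl)))
      where
      half<t : ∀ {x} → x ℤ.+ x ≡ M → x ℤ.< w t
      half<t 2x≡M = double-cancel-<
        (≡.subst (ℤ._< w t ℤ.+ w t) (≡.sym 2x≡M) (ℤₚ.+-monoˡ-< (w t) ws<wt))

      m<t : w m ℤ.< w t
      m<t = half<t 2m≡M

      tops : All (λ u → M ℤ.≤ w u ℤ.+ w u × w u ℤ.< w t) (m′ ∷ cs ++ us)
      tops = Allₚ.++⁺
        (All.map (λ 2c≡M → ℤₚ.≤-reflexive (≡.sym 2c≡M) , half<t 2c≡M) 2cs≡M) us-bounds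

      M≤+ : ∀ {x y} → M ℤ.≤ x ℤ.+ x × x ℤ.< w t → M ℤ.≤ y ℤ.+ y × y ℤ.< w t →
            M ℤ.≤ x ℤ.+ y
      M≤+ {x} {y} (M≤2x , _) (M≤2y , _) =
        Sum.[ ℤₚ.≤-trans M≤2x , ℤₚ.≤-trans M≤2y ]′ (+-≥-double x y)

      s+u<M : ∀ {x} → M ℤ.≤ x ℤ.+ x × x ℤ.< w t → ¬ M ℤ.≤ w s ℤ.+ x
      s+u<M (_ , x<t) = ℤₚ.<⇒≱ (ℤₚ.+-monoʳ-< (w s) x<t)

      -- The possible weights in the second summand apart from `m`: the maximum, or something
      -- strictly below the midpoint `w m`, with a gap in between.
      Bottom : ℤ → Set
      Bottom x = x ≡ w t ⊎ w s ℤ.≤ x × x ℤ.< w m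

      bottoms : All (Bottom ∘ w) (t ∷ ts ++ ls)
      bottoms = inj₁ ≡.refl ∷ Allₚ.++⁺ (All.map inj₁ ts≡t) (All.map
        (λ (2l<M , s≤l) → inj₂ (s≤l , double-cancel-< (≡.subst (_ ℤ.<_) (≡.sym 2m≡M) 2l<M)))
        ls-bounds)

      bottom≢m : ∀ {x} → Bottom x → x ≢ w m
      bottom≢m (inj₁ x≡t)       x≡m = ℤₚ.<-irrefl (≡.trans (≡.sym x≡m) x≡t) m<t
      bottom≢m (inj₂ (_ , x<m)) x≡m = ℤₚ.<-irrefl x≡m x<m

      s≤bottom : ∀ {x} → Bottom x → w s ℤ.≤ x
      s≤bottom (inj₁ x≡t)       = ≡.subst (w s ℤ.≤_) (≡.sym x≡t) (ℤₚ.<⇒≤ ws<wt)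
      s≤bottom (inj₂ (s≤x , _)) = s≤x

      -- Here `t` is adjacent to `m`. If `l` has maximal weight, then `j` has the weight of `m`,
      -- which lies in the gap; if `l` is below `m`, the right side weighs less than `M` and the
      -- left side at least `M`.
      side : ∀ {j l vs} → All (Bottom ∘ w) (t ∷ j ∷ l ∷ vs) → t ⊕ j ≢ m ⊕ l
      side {j} {l} (_ ∷ Lj ∷ Ll ∷ _) eq = by-cases Ll
        where
        t+j≡m+l : w t ℤ.+ w j ≡ w m ℤ.+ w l
        t+j≡m+l = w-parallelogram t j m l eq
        by-cases : Bottom (w l) → ⊥
        by-cases (inj₁ l≡t) = bottom≢m Lj (ℤ-cancelˡ (w t) _ _ (begin
          w t ℤ.+ w j  ≡⟨ t+j≡m+l ⟩
          w m ℤ.+ w l  ≡⟨ ≡.cong (ℤ._+_ (w m)) l≡t ⟩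
          w m ℤ.+ w t  ≡⟨ ℤₚ.+-comm (w m) (w t) ⟩
          w t ℤ.+ w m  ∎))
          where open ≡.≡-Reasoning
        by-cases (inj₂ (_ , l<m)) = ℤₚ.<-irrefl ≡.refl (begin-strict
          M            ≤⟨ ℤₚ.+-monoˡ-≤ (w t) (s≤bottom Lj) ⟩
          w j ℤ.+ w t  ≡⟨ ℤₚ.+-comm (w j) (w t) ⟩
          w t ℤ.+ w j  ≡⟨ t+j≡m+l ⟩
          w m ℤ.+ w l  <⟨ ℤₚ.+-monoʳ-< (w m) l<m ⟩
          w m ℤ.+ w m  ≡⟨ 2m≡M ⟩
          M            ∎)
          where open ℤₚ.≤-Reasoning

      -- Here `t` is opposite to `m`. If `i` or `j` has maximal weight, the other one has the weight
      -- of `m`; if both are below `m`, their sum is too small.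
      opposite : ∀ {i j vs} → All (Bottom ∘ w) (i ∷ j ∷ t ∷ vs) → i ⊕ j ≢ m ⊕ t
      opposite {i} {j} (Li ∷ Lj ∷ _) eq = by-cases Li Lj
        where
        i+j≡m+t : w i ℤ.+ w j ≡ w m ℤ.+ w t
        i+j≡m+t = w-parallelogram i j m t eq
        by-cases : Bottom (w i) → Bottom (w j) → ⊥
        by-cases (inj₁ i≡t) _ = bottom≢m Lj (ℤ-cancelˡ (w t) _ _ (begin
          w t ℤ.+ w j  ≡⟨ ≡.cong (ℤ._+ w j) i≡t ⟨
          w i ℤ.+ w j  ≡⟨ i+j≡m+t ⟩
          w m ℤ.+ w t  ≡⟨ ℤₚ.+-comm (w m) (w t) ⟩
          w t ℤ.+ w m  ∎))
          where open ≡.≡-Reasoning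
        by-cases _ (inj₁ j≡t) = bottom≢m Li (ℤ-cancelʳ (w t) _ _
          (≡.trans (≡.cong (ℤ._+_ (w i)) (≡.sym j≡t)) i+j≡m+t))
        by-cases (inj₂ (_ , i<m)) (inj₂ (_ , j<m)) = ℤₚ.<-irrefl i+j≡m+t
          (ℤₚ.+-mono-< i<m (ℤₚ.<-trans j<m m<t))

    between⇒sumOfTwoIrreducibles : ∀ ns → 1 ℕ.< length ns →
      All (λ n → w s ℤ.≤ w n × w n ℤ.≤ w t) ns → SumOfTwoIrreducibles (s ∷ t ∷ ns)
    between⇒sumOfTwoIrreducibles ns 1< bounds
      -- Four classes result: `ls` below the midpoint, `ts` at the maximum, `cs` exactly at the
      -- midpoint, and `us` strictly between midpoint and maximum.
      with ls , ns₁ , σ₁ , ls<M , ns₁≮M ← separate (λ n → w n ℤ.+ w n ℤₚ.<? M) ns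
      with ts , ns₂ , σ₂ , ts≡t , ns₂≢t ← separate (λ n → w n ℤₚ.≟ w t) ns₁
      with cs , us  , σ₃ , cs≡M , us≢M  ← separate (λ n → w n ℤ.+ w n ℤₚ.≟ M) ns₂ =
      by-middle cs cs≡M σ
      where
      σ : ns ↭ (cs ++ us) ++ ts ++ ls
      σ = begin
        ns                        ↭⟨ σ₁ ⟩
        ls ++ ns₁                 ↭⟨ ++⁺ˡ ls (↭-trans σ₂ (++⁺ˡ ts σ₃)) ⟩
        ls ++ ts ++ (cs ++ us)    ↭⟨ ++-comm ls (ts ++ (cs ++ us)) ⟩
        (ts ++ (cs ++ us)) ++ ls  ↭⟨ ++⁺ʳ ls (++-comm ts (cs ++ us)) ⟩
        ((cs ++ us) ++ ts) ++ ls  ≡⟨ Listₚ.++-assoc (cs ++ us) ts ls ⟩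
        (cs ++ us) ++ ts ++ ls    ∎
        where open PermutationReasoning

      ls-bounds : All (λ l → w s ℤ.≤ w l × w l ℤ.≤ w t) ls
      ls-bounds = Allₚ.++⁻ˡ ls (All-resp-↭ σ₁ bounds)

      ns₁-bounds : All (λ n → w s ℤ.≤ w n × w n ℤ.≤ w t) ns₁
      ns₁-bounds = Allₚ.++⁻ʳ ls (All-resp-↭ σ₁ bounds)

      us-bounds : All (λ u → M ℤ.≤ w u ℤ.+ w u × w u ℤ.< w t) us
      us-bounds = Allₚ.++⁻ʳ cs (All-resp-↭ σ₃ (All.zipWith
        (λ ((2n≮M , (_ , n≤t)) , n≢t) → ℤₚ.≮⇒≥ 2n≮M , ℤₚ.≤∧≢⇒< n≤t n≢t)
        (Allₚ.++⁻ʳ ts (All-resp-↭ σ₂ (All.zip (ns₁≮M , ns₁-bounds))) , ns₂≢t)))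

      M<2us : All (λ u → M ℤ.< w u ℤ.+ w u) (us ++ ts)
      M<2us = Allₚ.++⁺
        (All.zipWith (λ ((M≤2u , _) , 2u≢M) → ℤₚ.≤∧≢⇒< M≤2u (2u≢M ∘ ≡.sym)) (us-bounds , us≢M))
        (All.map (λ n≡t → ≡.subst (λ z → M ℤ.< z ℤ.+ z) (≡.sym n≡t) (ℤₚ.+-monoˡ-< (w t) ws<wt)) ts≡t)

      us-pairs : AllPairs (λ i j → M ℤ.< w i ℤ.+ w j) (us ++ ts)
      us-pairs = All⇒AllPairs (λ {i} {j} M<2i M<2j →
        Sum.[ ℤₚ.<-≤-trans M<2i , ℤₚ.<-≤-trans M<2j ]′ (+-≥-double (w i) (w j))) M<2us

      ls-pairs : AllPairs (λ i j → w i ℤ.+ w j ℤ.< M) ls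
      ls-pairs = All⇒AllPairs (λ {i} {j} 2i<M 2j<M →
        Sum.[ (λ ≤2i → ℤₚ.≤-<-trans ≤2i 2i<M) , (λ ≤2j → ℤₚ.≤-<-trans ≤2j 2j<M) ]′
          (+-≤-double (w i) (w j))) ls<M

      -- One midpoint term still has sums above `M` with all terms of `us ++ ts`. Two midpoint terms
      -- sum to exactly `M`, which is why the cases divide at two.
      c-pairs : ∀ c → w c ℤ.+ w c ≡ M → All (λ u → M ℤ.< w c ℤ.+ w u) (us ++ ts)
      c-pairs c 2c≡M = All.map (λ {u} M<2u → ≡.subst (ℤ._< w c ℤ.+ w u) 2c≡M
        (ℤₚ.+-monoʳ-< (w c) (double-cancel-< (≡.subst (ℤ._< w u ℤ.+ w u) (≡.sym 2c≡M) M<2u)))) M<2us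

      sparse : ∀ vs → AllPairs (λ i j → M ℤ.< w i ℤ.+ w j) vs → ns ↭ vs ++ ls →
               SumOfTwoIrreducibles (s ∷ t ∷ ns)
      sparse vs vs-pairs ρ = sum-resp-↭ (prep s (prep t ρ)) (sparse-middle vs ls
        (≡.subst (1 ℕ.<_) (↭-length ρ) 1<)
        vs-pairs (All.map proj₂ (Allₚ.++⁻ˡ vs (All-resp-↭ ρ bounds)))
        ls-pairs (All.map proj₁ ls-bounds))

      by-middle : ∀ cs → All (λ c → w c ℤ.+ w c ≡ M) cs → ns ↭ (cs ++ us) ++ ts ++ ls →
                  SumOfTwoIrreducibles (s ∷ t ∷ ns)
      by-middle [] _ ρ =
        sparse (us ++ ts) us-pairs (↭-trans ρ (↭-reflexive (≡.sym (Listₚ.++-assoc us ts ls))))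
      by-middle (c ∷ []) (2c≡M ∷ _) ρ =
        sparse (c ∷ us ++ ts) (c-pairs c 2c≡M ∷ us-pairs)
          (↭-trans ρ (↭-reflexive (≡.cong (c ∷_) (≡.sym (Listₚ.++-assoc us ts ls)))))
      by-middle (m ∷ m′ ∷ cs) cs≡M ρ = sum-resp-↭ (prep s (prep t ρ))
        (dense-middle m m′ cs us ts ls cs≡M us-bounds ts≡t
          (All.zipWith (λ (2l<M , (s≤l , _)) → 2l<M , s≤l) (ls<M , ls-bounds)))

  -- Choosing terms of minimal and maximal weight

  nonconstant⇒sumOfTwoIrreducibles : ∀ ns → 3 ℕ.< length ns →
    ∀ {m n} → m ∈ ns → n ∈ ns → Vec.lookup m r ≢ Vec.lookup n r → SumOfTwoIrreducibles ns
  nonconstant⇒sumOfTwoIrreducibles ns 3< {m} {n} m∈ n∈ m≢n =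
    with-min (proj₁ (∈⇒↭∷ s∈)) (proj₂ (∈⇒↭∷ s∈))
    where
    s t : Exponent k
    s = argmin w m ns
    t = argmax w m ns

    s∈ : s ∈ ns
    s∈ = argmin-all w m∈ (All.tabulate (λ n∈ → n∈))

    t∈ : t ∈ ns
    t∈ = argmax-all w m∈ (All.tabulate (λ n∈ → n∈))

    bounds : All (λ n → w s ℤ.≤ w n × w n ℤ.≤ w t) ns
    bounds = All.zip (f[argmin]≤f[xs] m ns , f[xs]≤f[argmax] m ns)

    ws<wt : w s ℤ.< w t
    ws<wt with (s≤m , m≤t) ← All.lookup bounds m∈ | (s≤n , n≤t) ← All.lookup bounds n∈ =
      ℤₚ.≰⇒> λ t≤s → m≢n (ℤₚ.≤-antisym
        (ℤₚ.≤-trans m≤t (ℤₚ.≤-trans t≤s s≤n)) (ℤₚ.≤-trans n≤t (ℤₚ.≤-trans t≤s s≤m)))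

    with-min : ∀ ns₁ → ns ↭ s ∷ ns₁ → SumOfTwoIrreducibles ns
    with-min ns₁ σ with ∈-resp-↭ σ t∈
    ... | here t≡s = contradiction ws<wt (ℤₚ.<-irrefl (≡.cong w (≡.sym t≡s)))
    ... | there t∈ns₁ with ns₂ , τ ← ∈⇒↭∷ t∈ns₁ =
      sum-resp-↭ ρ (between⇒sumOfTwoIrreducibles s t ws<wt ns₂
        -- More than three terms, less `s` and `t`, leave more than one: the bound that lets an
        -- empty side borrow a term.
        (ℕ.s<s⁻¹ (ℕ.s<s⁻¹ (≡.subst (3 ℕ.<_) (↭-length ρ) 3<)))
        (All.tail (All.tail (All-resp-↭ ρ bounds))))
      where
      ρ : ns ↭ s ∷ t ∷ ns₂
      ρ = ↭-trans σ (prep s τ)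

-- Back to Laurent polynomials

-- Every monomial takes the value 1 at `𝟙`, for negative exponents too because the inverse stored in
-- `𝟙` is 1; what remains is the sum of the coefficients.
eval-𝟙 : ∀ {k} (f : Laurent k) → eval f (replicate k 𝟙) ≡ length (expand f)
eval-𝟙 []            = ≡.refl
eval-𝟙 ((c , n) ∷ f) = begin
  c ℕ.* monomialAt (replicate _ 𝟙) n ℕ.+ eval f (replicate _ 𝟙)
    ≡⟨ ≡.cong₂ (λ x y → c ℕ.* x ℕ.+ y) (monomialAt-𝟙 n) (eval-𝟙 f) ⟩
  c ℕ.* 1 ℕ.+ length (expand f)
    ≡⟨ ≡.cong (ℕ._+ _) (≡.trans (ℕₚ.*-identityʳ c) (≡.sym (Listₚ.length-replicate c))) ⟩
  length (List.replicate c n) ℕ.+ length (expand f)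
    ≡⟨ Listₚ.length-++ (List.replicate c n) ⟨
  length (List.replicate c n ++ expand f) ∎
  where
  open ≡.≡-Reasoning
  𝟙^z≡1 : ∀ z → 𝟙 ^ᶻ z ≡ 1
  𝟙^z≡1 (ℤ.+ n)      = ℕₚ.^-zeroˡ n
  𝟙^z≡1 (ℤ.-[1+ n ]) = ℕₚ.^-zeroˡ (ℕ.suc n)

  monomialAt-𝟙 : ∀ {k} (n : Exponent k) → monomialAt (replicate k 𝟙) n ≡ 1
  monomialAt-𝟙 []      = ≡.refl
  monomialAt-𝟙 (z ∷ n) = ≡.cong₂ ℕ._*_ (𝟙^z≡1 z) (monomialAt-𝟙 n)

supp⊆expand : ∀ {k} (f : Laurent k) {n} → n ∈ supp f → n ∈ expand f
supp⊆expand f n∈ =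
  coeff-terms≢0⇒∈ (expand f) λ c≡0 →
    proj₂ (∈-filter⁻ (λ n → ¬? (coeff f n ℕₚ.≟ 0)) {xs = map proj₂ f} (∈-deduplicate⁻ _≟ᵉ_ _ n∈))
      (≡.trans (≋-terms-expand f _) c≡0)

-- Supplies the coordinate that serves as the weight. Decidable equality of integers makes the
-- search over the finitely many coordinates constructive.
differing-coordinate : ∀ {k} {m n : Exponent k} → m ≢ n →
                       ∃ λ r → Vec.lookup m r ≢ Vec.lookup n r
differing-coordinate {k} {m} {n} m≢n =
  ¬∀⟶∃¬ k _ (λ r → Vec.lookup m r ℤₚ.≟ Vec.lookup n r) λ eq → m≢n (begin
    m                            ≡⟨ Vecₚ.tabulate∘lookup m ⟨
    Vec.tabulate (Vec.lookup m)  ≡⟨ Vecₚ.tabulate-cong eq ⟩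
    Vec.tabulate (Vec.lookup n)  ≡⟨ Vecₚ.tabulate∘lookup n ⟩
    n                            ∎)
  where open ≡.≡-Reasoning

distinct-terms : ∀ {k} (f : Laurent k) → length (supp f) > 1 →
                 ∃₂ λ m n → m ∈ expand f × n ∈ expand f × m ≢ n
distinct-terms f 1<
  with supp f | supp⊆expand f
     | deduplicate-! _≟ᵉ_ (List.filter (λ n → ¬? (coeff f n ℕₚ.≟ 0)) (map proj₂ f))
... | m ∷ n ∷ _ | ∈supp⇒∈ | (m≢n ∷ _) ∷ _ =
  m , n , ∈supp⇒∈ (here ≡.refl) , ∈supp⇒∈ (there (here ≡.refl)) , m≢n
distinct-terms f ()        | []     | _ | _
distinct-terms f (ℕ.s≤s ()) | _ ∷ [] | _ | _

corollary3p8 : ∀ (k : ℕ) .{{_ : NonZero k}} (f : Laurent k) →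
    let open RawSemiring (ℕ[x^±1] k) in
    eval f (replicate k 𝟙) > 3 →
    length (supp f) > 1 →
    ∃₂ λ (g h : Laurent k) →
    MultiplicativeIrreducible (ℕ[x^±1] k) g ×
    MultiplicativeIrreducible (ℕ[x^±1] k) h ×
    f ≈ g + h
corollary3p8 k f f𝟙>3 1<supp
  with m , n , m∈ , n∈ , m≢n ← distinct-terms f 1<supp
  with r , mᵣ≢nᵣ ← differing-coordinate m≢n
  with gs , hs , gs-irr , hs-irr , σ ← nonconstant⇒sumOfTwoIrreducibles r (expand f)
         (≡.subst (_> 3) (eval-𝟙 f) f𝟙>3) m∈ n∈ mᵣ≢nᵣ =
  terms gs , terms hs , gs-irr , hs-irr ,
  expand-↭⇒≋ f (terms gs ++ terms hs) (↭-trans σ (↭-reflexive (≡.sym (≡.trans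
    (expand-++ (terms gs) (terms hs)) (≡.cong₂ _++_ (expand-terms gs) (expand-terms hs))))))
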